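{- Let $M$ be a matroid on a finite ground set $E$. Then the augmented Bergman complex $\Delta_M$ of $M$ is vertex decomposable.
   Context: For a matroid $M$ on $E$ with closure operator $f$, independent sets $I$ (those with $f(I\setminus\{i\})\subsetneq f(I)$ for all $i\in I$, equivalently the usual matroid independent sets) and flats (sets $F$ with $f(F)=F$), the augmented Bergman complex $\Delta_M$ is the simplicial complex with vertex set $\{y_i \mid i\in E\}\sqcup\{x_F \mid F \text{ a proper flat of } M\}$ (proper meaning $F\neq E$; the flat $f(\emptyset)$ is included), whose faces are the sets $\{y_i\mid i\in I\}\sqcup\{x_{F_1},\dots,x_{F_\ell}\}$ where $I$ is an independent set and $F_1\subsetneq F_2\subsetneq\cdots\subsetneq F_\ell\subsetneq E$ are flats with $f(I)\subseteq F_1$ ($\ell\ge 0$). A simplicial complex $\Delta$ is vertex decomposable if $\Delta$ is a simplex (including $\{\emptyset\}$), or inductively there is a vertex $v$ such that (i) the deletion $\mathrm{del}_\Delta(v)=\{\tau\setminus\{v\}\mid \tau\in\Delta\}$ and the link $\mathrm{link}_\Delta(v)=\{\tau\setminus\{v\}\mid v\in\tau\in\Delta\}$ are both vertex decomposable, and (ii) every facet of $\mathrm{del}_\Delta(v)$ is a facet of $\Delta$. -}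

module Defs where

open import Data.Nat using (ℕ)
open import Data.Bool using (Bool; true; false; _∧_; not)
open import Data.Bool.Properties using () renaming (_≟_ to _≟ᵇ_)
open import Data.Fin using (Fin)
open import Data.Fin.Properties using () renaming (_≟_ to _≟ᶠ_)
open import Data.Fin.Subset using (Subset; _∈_; _∉_; _⊆_; _⊂_; _∪_; _-_; ⁅_⁆; ⊤)
open import Data.Vec using (lookup)
open import Data.Vec.Properties as VecP using ()
open import Data.Sum using (_⊎_; inj₁; inj₂)
open import Data.Sum.Properties as SumP using ()
open import Data.Product using (Σ; _×_; _,_; ∃)
open import Data.List using (List; []; _∷_)
open import Data.List.Relation.Unary.All using (All)
open import Data.List.Relation.Unary.Linked using (Linked)
open import Data.List.Membership.Propositional using () renaming (_∈_ to _∈ˡ_)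
open import Data.Unit using () renaming (⊤ to Unit)
open import Relation.Binary.PropositionalEquality using (_≡_; _≢_)
open import Relation.Binary.Definitions using (DecidableEquality)
open import Relation.Nullary using (¬_)
open import Relation.Nullary.Decidable using (⌊_⌋)
open import Function.Bundles using (_⇔_)

record Matroid (n : ℕ) : Set where
  field
    cl          : Subset n → Subset n
    extensive   : ∀ X → X ⊆ cl X
    monotone    : ∀ X Y → X ⊆ Y → cl X ⊆ cl Y
    idempotent  : ∀ X → cl (cl X) ≡ cl X
    exchange    : ∀ X x y → y ∈ cl (X ∪ ⁅ x ⁆) → y ∉ cl X → x ∈ cl (X ∪ ⁅ y ⁆)

module _ {n : ℕ} (M : Matroid n) where
  open Matroid M

  Independent : Subset n → Set
  Independent I = ∀ i → i ∈ I → cl (I - i) ⊂ cl I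

  IsFlat : Subset n → Set
  IsFlat F = cl F ≡ F

  IsProperFlat : Subset n → Set
  IsProperFlat F = IsFlat F × F ≢ ⊤

  ChainAbove : Subset n → List (Subset n) → Set
  ChainAbove I []      = Unit
  ChainAbove I (F ∷ _) = cl I ⊆ F

  -- vertices: inj₁ i is y_i ; inj₂ F is x_F (only proper flats F ever occur in faces)
  BVertex : Set
  BVertex = Fin n ⊎ Subset n

  -- a face is given by its indicator function on vertices
  AugBergman : (BVertex → Bool) → Set
  AugBergman τ =
    Σ (Subset n) λ I → Σ (List (Subset n)) λ Fs →
      Independent I × All IsProperFlat Fs × Linked _⊂_ Fs × ChainAbove I Fs ×
      (∀ i → τ (inj₁ i) ≡ lookup I i) ×
      (∀ F → (τ (inj₂ F) ≡ true) ⇔ (F ∈ˡ Fs))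

BVertex-≟ : ∀ {n} → DecidableEquality (Fin n ⊎ Subset n)
BVertex-≟ = SumP.≡-dec _≟ᶠ_ (VecP.≡-dec _≟ᵇ_)

-- Simplicial complexes on a vertex type V (faces = indicator functions)

Complex : Set → Set₁
Complex V = (V → Bool) → Set

module _ {V : Set} (_≟_ : DecidableEquality V) where

  _⊆ᶠ_ : (V → Bool) → (V → Bool) → Set
  σ ⊆ᶠ τ = ∀ v → σ v ≡ true → τ v ≡ true

  remove : V → (V → Bool) → (V → Bool)
  remove v τ u = τ u ∧ not ⌊ u ≟ v ⌋

  IsVertex : Complex V → V → Set
  IsVertex Δ v = Σ (V → Bool) λ τ → Δ τ × τ v ≡ true

  IsSimplex : Complex V → Set
  IsSimplex Δ = Σ (V → Bool) λ σ → ∀ τ → Δ τ ⇔ (τ ⊆ᶠ σ)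

  del : V → Complex V → Complex V
  del v Δ τ = Σ (V → Bool) λ τ′ → Δ τ′ × (∀ u → τ u ≡ remove v τ′ u)

  link : V → Complex V → Complex V
  link v Δ τ = Σ (V → Bool) λ τ′ → Δ τ′ × τ′ v ≡ true × (∀ u → τ u ≡ remove v τ′ u)

  IsFacet : Complex V → (V → Bool) → Set
  IsFacet Δ σ = Δ σ × (∀ τ → Δ τ → σ ⊆ᶠ τ → τ ⊆ᶠ σ)

  data VertexDecomposable (Δ : Complex V) : Set₁ where
    simplex : IsSimplex Δ → VertexDecomposable Δ
    shed    : (v : V) → IsVertex Δ v →
              VertexDecomposable (del v Δ) →
              VertexDecomposable (link v Δ) →
              (∀ σ → IsFacet (del v Δ) σ → IsFacet Δ σ) →
              VertexDecomposable Δ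

{-# OPTIONS --safe #-}
module Submission where

-- The vertices x_F are shed one at a time, smaller flats first, until only the
-- independence complex is left. When F is shed, no smaller flat remains, so its link is the join of
-- the independence complex of the restriction to F with the order complex of the open interval
-- (F, E) in the lattice of flats. Shedding is legitimate because a chain of flats above F together
-- with an independent subset of F can always be enlarged by some y_i: take i outside F and in the
-- smallest flat of the chain. Independence complexes are decomposed by shedding elements that are
-- neither loops nor coloops. An interval (F, G) of flats is decomposed by fixing a in G but not in F
-- and shedding the flats that avoid a; the flats that contain a form a cone with apex F ∨ a.

open import Defs
open import Data.Nat using (ℕ; zero; suc; _+_; _≤_; _<_)
import Data.Nat.Properties as ℕₚ
open import Data.Nat.Induction using (<-wellFounded)
open import Induction.WellFounded using (Acc; acc)
open import Data.Bool using (Bool; true; false; _∧_; _∨_; not)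
open import Data.Bool.Properties using (¬-not; ∨-zeroʳ) renaming (_≟_ to _≟ᵇ_)
open import Data.Fin using (Fin)
open import Data.Fin.Properties using (any?) renaming (_≟_ to _≟ᶠ_)
open import Data.Fin.Subset
  using (Subset; _∈_; _∉_; _⊆_; _⊂_; _∪_; _─_; _-_; ⁅_⁆; ⊤; ⊥; ∁; ∣_∣)
open import Data.Fin.Subset.Properties
open import Data.Vec using (lookup; tabulate; []; _∷_; here; there)
open import Data.Vec.Properties using (lookup∘tabulate; lookup⇒[]=; []=⇒lookup; ≡-dec)
open import Data.Sum using (_⊎_; inj₁; inj₂; [_,_]′; swap; map₂)
open import Data.Product using (_×_; _,_; ∃; proj₁; proj₂)
open import Data.List using (List; []; _∷_; map; filter; _++_)
open import Data.List.Membership.Propositional.Properties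
  using (∈-++⁺ˡ; ∈-++⁺ʳ; ∈-map⁺; ∈-filter⁺; ∈-filter⁻)
open import Data.List.Relation.Unary.All using (All; []; _∷_)
open import Data.List.Relation.Unary.AllPairs using (AllPairs; []; _∷_)
import Data.List.Relation.Unary.All as All
import Data.List.Relation.Unary.All.Properties as All
import Data.List.Relation.Unary.AllPairs as AllPairs
import Data.List.Relation.Unary.AllPairs.Properties as AllPairs
open import Data.List.Relation.Unary.Any using (here; there)
open import Data.List.Membership.Propositional using () renaming (_∈_ to _∈ˡ_)
open import Data.List.Relation.Unary.Linked using (Linked; _∷_)
open import Data.List.Relation.Unary.Linked.Properties using (Linked⇒AllPairs; AllPairs⇒Linked)
open import Data.Empty using (⊥-elim)
open import Relation.Binary.PropositionalEquality
  using (_≡_; _≢_; refl; sym; trans; cong; cong₂; subst)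
open import Relation.Binary.Definitions using (DecidableEquality)
open import Relation.Nullary using (¬_; Dec; yes; no)
open import Relation.Nullary.Decidable using (⌊_⌋; map′; _×-dec_; ¬?; decidable-stable)
open import Function.Bundles using (_⇔_; mk⇔; Equivalence)
open import Function using (case_of_; _∘_; id; flip)

open Equivalence using (to; from)

-- Complexes with the same faces.

infix 4 _≈_
_≈_ : ∀ {V} → Complex V → Complex V → Set
Δ ≈ Θ = ∀ τ → Δ τ ⇔ Θ τ

≈-sym : ∀ {V} {Δ Θ : Complex V} → Δ ≈ Θ → Θ ≈ Δ
≈-sym e τ = mk⇔ (from (e τ)) (to (e τ))

≈-trans : ∀ {V} {Δ Θ Ξ : Complex V} → Δ ≈ Θ → Θ ≈ Ξ → Δ ≈ Ξ
≈-trans e f τ = mk⇔ (to (f τ) ∘ to (e τ)) (from (e τ) ∘ from (f τ))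

-- Set operations on faces given by indicator functions.

module Decomposition {V : Set} (_≟_ : DecidableEquality V) where

  infix 4 _∈ᶠ_ _∉ᶠ_ _⊑_
  -- A record rather than a synonym, so that the face can be inferred from a membership proof.
  record _∈ᶠ_ (v : V) (τ : V → Bool) : Set where
    constructor mem
    field isTrue : τ v ≡ true
  open _∈ᶠ_ public

  _∉ᶠ_ : V → (V → Bool) → Set
  v ∉ᶠ τ = ¬ v ∈ᶠ τ

  _∈ᶠ?_ : ∀ v τ → Dec (v ∈ᶠ τ)
  v ∈ᶠ? τ = map′ mem isTrue (τ v ≟ᵇ true)

  _⊑_ : (V → Bool) → (V → Bool) → Set
  σ ⊑ τ = ∀ u → u ∈ᶠ σ → u ∈ᶠ τ

  ∅ᶠ : V → Bool
  ∅ᶠ _ = false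

  ∉∅ : ∀ {u} → u ∉ᶠ ∅ᶠ
  ∉∅ (mem ())

  point : V → V → Bool
  point v u = ⌊ u ≟ v ⌋

  ∈-point⁻ : ∀ {v u} → u ∈ᶠ point v → u ≡ v
  ∈-point⁻ {v} {u} (mem p) with u ≟ v
  ... | yes e = e

  ∈-point⁺ : ∀ {v} → v ∈ᶠ point v
  ∈-point⁺ {v} with v ≟ v in eq
  ... | yes _ = mem (cong ⌊_⌋ eq)
  ... | no ¬e = ⊥-elim (¬e refl)

  opaque
    -- These operations are opaque so that their arguments can be inferred from a membership proof.
    add : V → (V → Bool) → (V → Bool)
    add v τ u = τ u ∨ point v u

    _∩ᶠ_ _∖ᶠ_ : (V → Bool) → (V → Bool) → (V → Bool)
    (τ ∩ᶠ A) u = τ u ∧ A u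
    (τ ∖ᶠ A) u = τ u ∧ not (A u)

    ∈-add⁻ : ∀ {v τ u} → u ∈ᶠ add v τ → u ∈ᶠ τ ⊎ u ≡ v
    ∈-add⁻ {v} {τ} {u} (mem p) with τ u in eq
    ... | true  = inj₁ (mem eq)
    ... | false = inj₂ (∈-point⁻ (mem p))

    ∈-add⁺ˡ : ∀ {v τ u} → u ∈ᶠ τ → u ∈ᶠ add v τ
    ∈-add⁺ˡ {v} {u = u} (mem p) = mem (cong (_∨ point v u) p)

    ∈-add⁺ʳ : ∀ {v τ} → v ∈ᶠ add v τ
    ∈-add⁺ʳ {v} {τ} =
      mem (trans (cong (τ v ∨_) (isTrue ∈-point⁺)) (∨-zeroʳ (τ v)))

    ∈-∩⁺ : ∀ {τ A u} → u ∈ᶠ τ → u ∈ᶠ A → u ∈ᶠ τ ∩ᶠ A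
    ∈-∩⁺ (mem p) (mem q) = mem (cong₂ _∧_ p q)

    ∈-∩⁻ : ∀ {τ A u} → u ∈ᶠ τ ∩ᶠ A → u ∈ᶠ τ × u ∈ᶠ A
    ∈-∩⁻ {τ} {A} {u} (mem p) with τ u in e | A u in f
    ... | true | true = mem e , mem f

    ∈-∖⁺ : ∀ {τ A u} → u ∈ᶠ τ → u ∉ᶠ A → u ∈ᶠ τ ∖ᶠ A
    ∈-∖⁺ (mem p) q = mem (cong₂ (λ a b → a ∧ not b) p (¬-not (q ∘ mem)))

    ∈-∖⁻ : ∀ {τ A u} → u ∈ᶠ τ ∖ᶠ A → u ∈ᶠ τ × u ∉ᶠ A
    ∈-∖⁻ {τ} {A} {u} (mem p) with τ u in e | A u in f
    ... | true | false = mem e , λ (mem g) → case trans (sym f) g of λ ()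

  add-⊑ : ∀ {v τ σ} → v ∈ᶠ σ → τ ⊑ σ → add v τ ⊑ σ
  add-⊑ v∈σ τ⊑σ u u∈ with ∈-add⁻ u∈
  ... | inj₁ u∈τ  = τ⊑σ u u∈τ
  ... | inj₂ refl = v∈σ

  ∈-not⁺ : ∀ {A u} → u ∉ᶠ A → u ∈ᶠ not ∘ A
  ∈-not⁺ n = mem (cong not (¬-not (n ∘ mem)))

  ∉-not⁺ : ∀ {A u} → u ∈ᶠ A → u ∉ᶠ not ∘ A
  ∉-not⁺ (mem p) (mem q) = case trans (sym (cong not p)) q of λ ()

  ∉-not⁻ : ∀ {A u} → u ∉ᶠ not ∘ A → u ∈ᶠ A
  ∉-not⁻ {A} {u} n with A u in e
  ... | true  = mem e
  ... | false = ⊥-elim (n (mem (cong not e)))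

  remove⁻ : ∀ v τ {u} → u ∈ᶠ remove _≟_ v τ → u ∈ᶠ τ × u ≢ v
  remove⁻ v τ {u} (mem p) with τ u in e | u ≟ v
  ... | true | no ¬e = mem e , ¬e

  remove⁺ : ∀ v τ {u} → u ∈ᶠ τ → u ≢ v → u ∈ᶠ remove _≟_ v τ
  remove⁺ v τ (mem p) q = mem (cong₂ _∧_ p (isTrue (∈-not⁺ {point v} (q ∘ ∈-point⁻))))

  ≡⇒⊑ : ∀ {σ τ} → (∀ u → σ u ≡ τ u) → σ ⊑ τ
  ≡⇒⊑ e u (mem p) = mem (trans (sym (e u)) p)

  ⊑-antisym : ∀ {σ τ} → σ ⊑ τ → τ ⊑ σ → ∀ u → σ u ≡ τ u
  ⊑-antisym {σ} {τ} p q u with u ∈ᶠ? σ | u ∈ᶠ? τ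
  ... | yes a | _     = trans (isTrue a) (sym (isTrue (p u a)))
  ... | no _  | yes b = trans (isTrue (q u b)) (sym (isTrue b))
  ... | no a  | no b  = trans (¬-not (a ∘ mem)) (sym (¬-not (b ∘ mem)))

  -- Vertex decomposability of down-closed complexes.

  DownClosed : Complex V → Set
  DownClosed Δ = ∀ {σ τ} → σ ⊑ τ → Δ τ → Δ σ

  -- On down-closed complexes these agree with `del` and `link`, but they test `τ` itself instead of
  -- asking for a face `τ′` that yields it.
  Del Link : V → Complex V → Complex V
  Del v Δ τ = Δ τ × v ∉ᶠ τ
  Link v Δ τ = Δ (add v τ) × v ∉ᶠ τ

  Simplex : (V → Bool) → Complex V
  Simplex S τ = τ ⊑ S

  -- For a down-closed Δ the facet condition on v says that a face of the link of v
  -- can always be enlarged by a vertex other than v.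
  Exchangeable : Complex V → V → Set
  Exchangeable Δ v = ∀ τ → Link v Δ τ → ∃ λ w → w ≢ v × w ∉ᶠ τ × Δ (add w τ)

  -- The working form of `VertexDecomposable`, built from `Del`, `Link` and `Exchangeable`;
  -- `vertexDecomposable` translates back.
  data Decomposable (Δ : Complex V) : Set₁ where
    simplex : ∀ S → Δ ≈ Simplex S → Decomposable Δ
    shed    : ∀ v → Δ (add v ∅ᶠ) → Decomposable (Del v Δ) → Decomposable (Link v Δ) →
              Exchangeable Δ v → Decomposable Δ

  Del-cong : ∀ {Δ Θ v} → Δ ≈ Θ → Del v Δ ≈ Del v Θ
  Del-cong e τ = mk⇔ (λ (d , n) → to (e _) d , n) (λ (d , n) → from (e _) d , n)

  Link-cong : ∀ {Δ Θ v} → Δ ≈ Θ → Link v Δ ≈ Link v Θ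
  Link-cong e τ = mk⇔ (λ (d , n) → to (e _) d , n) (λ (d , n) → from (e _) d , n)

  Decomposable-resp : ∀ {Δ Θ} → Δ ≈ Θ → Decomposable Δ → Decomposable Θ
  Decomposable-resp e (simplex S s) = simplex S (≈-trans (≈-sym e) s)
  Decomposable-resp e (shed v vx d l ex) =
    shed v (to (e _) vx) (Decomposable-resp (Del-cong e) d) (Decomposable-resp (Link-cong e) l)
      λ τ (t , n) → let w , w≢v , w∉τ , f = ex τ (from (e _) t , n) in w , w≢v , w∉τ , to (e _) f

  Simplex-downClosed : ∀ {S} → DownClosed (Simplex S)
  Simplex-downClosed p q u = q u ∘ p u

  ≈-downClosed : ∀ {Δ Θ} → Δ ≈ Θ → DownClosed Θ → DownClosed Δ
  ≈-downClosed e dc p = from (e _) ∘ dc p ∘ to (e _)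

  Del-downClosed : ∀ {Δ v} → DownClosed Δ → DownClosed (Del v Δ)
  Del-downClosed dc p (d , n) = dc p d , n ∘ p _

  Link-downClosed : ∀ {Δ v} → DownClosed Δ → DownClosed (Link v Δ)
  Link-downClosed dc p (d , n) = dc (add-⊑ ∈-add⁺ʳ (λ u → ∈-add⁺ˡ ∘ p u)) d , n ∘ p _

  -- Down-closure keeps a face in `Δ` after `v` is taken out; conversely, a face that avoids `v` is
  -- its own deletion.
  del≈Del : ∀ {Δ v} → DownClosed Δ → del _≟_ v Δ ≈ Del v Δ
  del≈Del {v = v} dc τ = mk⇔
    (λ (τ′ , d , e) → dc (λ u → proj₁ ∘ remove⁻ v τ′ ∘ ≡⇒⊑ e u) d
                    , λ v∈τ → proj₂ (remove⁻ v τ′ (≡⇒⊑ e _ v∈τ)) refl)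
    (λ (d , n) → τ , d , ⊑-antisym (λ u u∈ → remove⁺ v τ u∈ λ { refl → n u∈ })
                                   (λ u → proj₁ ∘ remove⁻ v τ))

  link≈Link : ∀ {Δ v} → DownClosed Δ → link _≟_ v Δ ≈ Link v Δ
  link≈Link {v = v} dc τ = mk⇔
    (λ (τ′ , d , v∈ , e) → dc (add-⊑ (mem v∈) λ u → proj₁ ∘ remove⁻ v τ′ ∘ ≡⇒⊑ e u) d
                         , λ v∈τ → proj₂ (remove⁻ v τ′ (≡⇒⊑ e _ v∈τ)) refl)
    (λ (d , n) → add v τ , d , isTrue ∈-add⁺ʳ
               , ⊑-antisym (λ u u∈ → remove⁺ v (add v τ) (∈-add⁺ˡ u∈) λ { refl → n u∈ })
                           (λ u u∈ → let u∈add , u≢v = remove⁻ v (add v τ) u∈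
                                     in [ id , ⊥-elim ∘ u≢v ]′ (∈-add⁻ u∈add)))

  -- Induction on the decomposition. `Δ` is kept apart from `Θ` because the deletion and link of `Δ`
  -- match `Del` and `Link` of `Θ` only up to `≈`.
  vertexDecomposable : ∀ {Δ Θ} → DownClosed Θ → Δ ≈ Θ → Decomposable Θ →
                       VertexDecomposable _≟_ Δ
  vertexDecomposable dc e (simplex S s) =
    simplex (S , ≈-trans e (≈-trans s λ τ →
      mk⇔ (λ p u → isTrue ∘ p u ∘ mem) (λ p u → mem ∘ p u ∘ isTrue)))
  vertexDecomposable {Δ} {Θ} dc e (shed v vx d l ex) =
    shed v (add v ∅ᶠ , from (e _) vx , isTrue ∈-add⁺ʳ)
      (vertexDecomposable (Del-downClosed dc) del≈ d)
      (vertexDecomposable (Link-downClosed dc)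
        (≈-trans (link≈Link (≈-downClosed e dc)) (Link-cong e)) l)
      facet
    where
    del≈ : del _≟_ v Δ ≈ Del v Θ
    del≈ = ≈-trans (del≈Del (≈-downClosed e dc)) (Del-cong e)
    facet : ∀ σ → IsFacet _≟_ (del _≟_ v Δ) σ → IsFacet _≟_ Δ σ
    facet σ (σ∈del , max) with to (del≈ σ) σ∈del
    ... | σ∈Θ , v∉σ = from (e σ) σ∈Θ , max′
      where
      max′ : ∀ τ → Δ τ → _⊆ᶠ_ _≟_ σ τ → _⊆ᶠ_ _≟_ τ σ
      max′ τ τ∈Δ σ⊆τ with v ∈ᶠ? τ
      ... | no v∉τ  = max τ (from (del≈ τ) (to (e τ) τ∈Δ , v∉τ)) σ⊆τ
      -- Here `σ` is in the link of `v`, and the vertex `w` from the exchange would enlarge it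
      -- within the deletion, against maximality.
      ... | yes v∈τ =
        let w , w≢v , w∉σ , f =
              ex σ (dc (add-⊑ v∈τ λ u → mem ∘ σ⊆τ u ∘ isTrue) (to (e τ) τ∈Δ) , v∉σ)
            v∉ = λ p → [ v∉σ , w≢v ∘ sym ]′ (∈-add⁻ p)
        in ⊥-elim (w∉σ (mem (max (add w σ) (from (del≈ _) (f , v∉))
                                 (λ u → isTrue ∘ ∈-add⁺ˡ ∘ mem) w (isTrue ∈-add⁺ʳ))))

  -- Joins and cones.

  -- The predicate `A` tells the vertices of `Δ₁` from those of `Δ₂`.
  Join : (V → Bool) → Complex V → Complex V → Complex V
  Join A Δ₁ Δ₂ τ = Δ₁ (τ ∩ᶠ A) × Δ₂ (τ ∖ᶠ A)

  SupportedIn : (V → Bool) → Complex V → Set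
  SupportedIn A Δ = ∀ {τ} → Δ τ → τ ⊑ A

  private
    ⊑∅ : ∀ {τ S} → (∀ u → u ∉ᶠ τ) → τ ⊑ S
    ⊑∅ e u u∈ = ⊥-elim (e u u∈)

  -- The decomposition of `Δ₁` is replayed inside the join while `Δ₂` stays fixed; `base` treats the
  -- simplices reached at its leaves. The empty face of `Δ₂` turns vertices of `Δ₁` into vertices of
  -- the join.
  Join-lift : ∀ {A Δ₁ Δ₂ Θ} → DownClosed Δ₁ → DownClosed Δ₂ → SupportedIn A Δ₁ → Δ₂ ∅ᶠ →
              (∀ {Θ′} S → S ⊑ A → Θ′ ≈ Join A (Simplex S) Δ₂ → Decomposable Θ′) →
              Decomposable Δ₁ → Θ ≈ Join A Δ₁ Δ₂ → Decomposable Θ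
  Join-lift dc₁ dc₂ s ∅∈Δ₂ base (simplex S e) j =
    -- `S` is itself a face of `Δ₁`, hence supported in `A`.
    base S (s (from (e S) λ _ → id))
         λ τ → mk⇔ (λ t → to (e _) (proj₁ (to (j τ) t)) , proj₂ (to (j τ) t))
                   (λ (a , b) → from (j τ) (from (e _) a , b))
  Join-lift {A} {Δ₁} {Δ₂} {Θ} dc₁ dc₂ s ∅∈Δ₂ base (shed v vx d l ex) j =
    shed v (from (j _) (dc₁ (λ u → proj₁ ∘ ∈-∩⁻) vx , dc₂ (⊑∅ ∉v) ∅∈Δ₂))
      (Join-lift (Del-downClosed dc₁) dc₂ (s ∘ proj₁) ∅∈Δ₂ base d del-join)
      (Join-lift (Link-downClosed dc₁) dc₂
        (λ t u → s (proj₁ t) u ∘ ∈-add⁺ˡ) ∅∈Δ₂ base l link-join)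
      exch
    where
    v∈A : v ∈ᶠ A
    v∈A = s vx v ∈-add⁺ʳ
    ∉v : ∀ u → u ∉ᶠ add v ∅ᶠ ∖ᶠ A
    ∉v u p with ∈-∖⁻ p
    ... | q , n with ∈-add⁻ q
    ... | inj₁ ()
    ... | inj₂ refl = n v∈A
    ∩-add : ∀ {w τ} → w ∈ᶠ A → add w (τ ∩ᶠ A) ⊑ add w τ ∩ᶠ A
    ∩-add w∈A = add-⊑ (∈-∩⁺ ∈-add⁺ʳ w∈A) λ u p → let a , b = ∈-∩⁻ p in ∈-∩⁺ (∈-add⁺ˡ a) b
    add-∩ : ∀ {w τ} → add w τ ∩ᶠ A ⊑ add w (τ ∩ᶠ A)
    add-∩ {w} {τ} u p with ∈-∩⁻ p
    ... | a , b with ∈-add⁻ a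
    ... | inj₁ c    = ∈-add⁺ˡ (∈-∩⁺ c b)
    ... | inj₂ refl = ∈-add⁺ʳ
    add-∖ : ∀ {w τ} → w ∈ᶠ A → add w τ ∖ᶠ A ⊑ τ ∖ᶠ A
    add-∖ {w} {τ} w∈A u p with ∈-∖⁻ p
    ... | a , b with ∈-add⁻ a
    ... | inj₁ c    = ∈-∖⁺ c b
    ... | inj₂ refl = ⊥-elim (b w∈A)
    ∖-add : ∀ {w τ} → τ ∖ᶠ A ⊑ add w τ ∖ᶠ A
    ∖-add {w} {τ} u p = let a , b = ∈-∖⁻ p in ∈-∖⁺ (∈-add⁺ˡ a) b
    del-join : Del v Θ ≈ Join A (Del v Δ₁) Δ₂
    del-join τ = mk⇔
      (λ (t , n) → let a , b = to (j τ) t in (a , n ∘ proj₁ ∘ ∈-∩⁻) , b)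
      (λ ((a , n) , b) → from (j τ) (a , b) , λ p → n (∈-∩⁺ p v∈A))
    link-join : Link v Θ ≈ Join A (Link v Δ₁) Δ₂
    link-join τ = mk⇔
      (λ (t , n) → let a , b = to (j _) t in
        (dc₁ (∩-add v∈A) a , n ∘ proj₁ ∘ ∈-∩⁻) , dc₂ ∖-add b)
      (λ ((a , n) , b) → from (j _) (dc₁ add-∩ a , dc₂ (add-∖ v∈A) b) , λ p → n (∈-∩⁺ p v∈A))
    exch : Exchangeable Θ v
    exch τ t with to (link-join τ) t
    ... | a , b with ex _ a
    ... | w , w≢v , w∉ , f =
      let w∈A = s f w ∈-add⁺ʳ
      in w , w≢v , (λ p → w∉ (∈-∩⁺ p w∈A)) , from (j _) (dc₁ add-∩ f , dc₂ (add-∖ w∈A) b)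

  Decomposable⇒∅ : ∀ {Δ} → DownClosed Δ → Decomposable Δ → Δ ∅ᶠ
  Decomposable⇒∅ dc (simplex S e)     = from (e _) λ _ → ⊥-elim ∘ ∉∅
  Decomposable⇒∅ dc (shed v vx _ _ _) = dc (λ _ → ⊥-elim ∘ ∉∅) vx

  Join-swap : ∀ {A Δ₁ Δ₂} → DownClosed Δ₁ → DownClosed Δ₂ →
              Join A Δ₁ Δ₂ ≈ Join (not ∘ A) Δ₂ Δ₁
  Join-swap dc₁ dc₂ τ = mk⇔
    (λ (a , b) → dc₂ (λ u p → let c , d = ∈-∩⁻ p in ∈-∖⁺ c λ q → ∉-not⁺ q d) b
               , dc₁ (λ u p → let c , d = ∈-∖⁻ p in ∈-∩⁺ c (∉-not⁻ d)) a)
    (λ (b , a) → dc₁ (λ u p → let c , d = ∈-∩⁻ p in ∈-∖⁺ c (∉-not⁺ d)) a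
               , dc₂ (λ u p → let c , d = ∈-∖⁻ p in ∈-∩⁺ c (∈-not⁺ d)) b)

  -- The decomposition of `Δ₁` is replayed first; at each leaf the factors are swapped and that of
  -- `Δ₂` is replayed. What remains is a join of two simplices, which is a simplex.
  Join-decomposable : ∀ {A Δ₁ Δ₂ Θ} → DownClosed Δ₁ → DownClosed Δ₂ →
    SupportedIn A Δ₁ → SupportedIn (not ∘ A) Δ₂ → Decomposable Δ₁ → Decomposable Δ₂ →
    Θ ≈ Join A Δ₁ Δ₂ → Decomposable Θ
  Join-decomposable {A} dc₁ dc₂ s₁ s₂ D₁ D₂ =
    Join-lift dc₁ dc₂ s₁ (Decomposable⇒∅ dc₂ D₂)
      (λ S S⊑A e →
        Join-lift dc₂ Simplex-downClosed s₂ (λ _ → ⊥-elim ∘ ∉∅) (simplices S⊑A) D₂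
          (≈-trans e (Join-swap Simplex-downClosed dc₂)))
      D₁
    where
    simplices : ∀ {S Θ′} → S ⊑ A → ∀ T → T ⊑ not ∘ A →
                Θ′ ≈ Join (not ∘ A) (Simplex T) (Simplex S) → Decomposable Θ′
    simplices {S} S⊑A T T⊑ e = simplex U (≈-trans e λ τ → mk⇔
      (λ (a , b) u p → cover a b p (u ∈ᶠ? (not ∘ A)))
      (λ a → (λ u p → let c , d = ∈-∩⁻ p in
                [ (λ s → ⊥-elim (∉-not⁺ (S⊑A u s) d)) , id ]′ (U⁻ (a u c)))
           , (λ u p → let c , d = ∈-∖⁻ p in [ id , ⊥-elim ∘ d ∘ T⊑ u ]′ (U⁻ (a u c)))))
      where
      U : V → Bool
      U u = S u ∨ T u
      U⁻ : ∀ {u} → u ∈ᶠ U → u ∈ᶠ S ⊎ u ∈ᶠ T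
      U⁻ {u} (mem p) with S u in e
      ... | true  = inj₁ (mem e)
      ... | false = inj₂ (mem p)
      cover : ∀ {τ u} → τ ∩ᶠ (not ∘ A) ⊑ T → τ ∖ᶠ (not ∘ A) ⊑ S → u ∈ᶠ τ →
              Dec (u ∈ᶠ not ∘ A) → u ∈ᶠ U
      cover {u = u} a b p (yes q) =
        mem (trans (cong (S u ∨_) (isTrue (a u (∈-∩⁺ p q)))) (∨-zeroʳ (S u)))
      cover {u = u} a b p (no q) = mem (cong (_∨ T u) (isTrue (b u (∈-∖⁺ p q))))

  -- A cone is the join of its base with the simplex on the apex.
  cone-decomposable : ∀ {Δ Θ} v → DownClosed Δ → (∀ {τ} → Δ τ → v ∉ᶠ τ) → Decomposable Δ →
                      (∀ τ → Θ τ ⇔ Δ (remove _≟_ v τ)) → Decomposable Θ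
  cone-decomposable {Δ} v dc v∉ D e =
    Join-decomposable {A = point v} Simplex-downClosed dc (λ p → p)
      (λ d u p → ∈-not⁺ λ q → v∉ d (subst (_∈ᶠ _) (∈-point⁻ q) p))
      (simplex (point v) λ _ → mk⇔ id id) D
      (λ τ → mk⇔
        (λ t → (λ u → proj₂ ∘ ∈-∩⁻)
             , dc (λ u p → let a , b = ∈-∖⁻ p in remove⁺ v τ a λ { refl → b ∈-point⁺ })
                  (to (e τ) t))
        (λ (_ , d) → from (e τ)
          (dc (λ u p → let a , b = remove⁻ v τ p in ∈-∖⁺ a (b ∘ ∈-point⁻)) d)))

-- Finite subsets.

module _ {n : ℕ} where

  ∈-─⁻ : ∀ {m} {x : Fin m} (p q : Subset m) → x ∈ p ─ q → x ∉ q
  ∈-─⁻ (_ ∷ p) (_ ∷ q) (there x∈) (there x∈q) = ∈-─⁻ p q x∈ x∈q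
  ∈-─⁻ (_ ∷ p) (true ∷ q) () here

  ∈-⁻ : ∀ {p : Subset n} {x y} → x ∈ p - y → x ∈ p × x ≢ y
  ∈-⁻ {p} {x} {y} x∈ = p─q⊆p p ⁅ y ⁆ x∈ , λ { refl → ∈-─⁻ p ⁅ x ⁆ x∈ (x∈⁅x⁆ x) }

  ∪-lub : ∀ {p q r : Subset n} → p ⊆ r → q ⊆ r → p ∪ q ⊆ r
  ∪-lub {p} {q} p⊆r q⊆r x∈ = [ p⊆r , q⊆r ]′ (x∈p∪q⁻ p q x∈)

  ⁅⁆⊆ : ∀ {p : Subset n} {x} → x ∈ p → ⁅ x ⁆ ⊆ p
  ⁅⁆⊆ {p} {x} x∈p y∈ = subst (_∈ p) (sym (x∈⁅y⁆⇒x≡y x y∈)) x∈p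

  ⊆∪ˡ : ∀ {p q : Subset n} → p ⊆ p ∪ q
  ⊆∪ˡ {p} {q} = p⊆p∪q q

  ⊆∪ʳ : ∀ {p q : Subset n} → q ⊆ p ∪ q
  ⊆∪ʳ {p} {q} = q⊆p∪q p q

  ∈∪⁅⁆ : ∀ {p : Subset n} {x} → x ∈ p ∪ ⁅ x ⁆
  ∈∪⁅⁆ {p} {x} = ⊆∪ʳ {p} (x∈⁅x⁆ x)

  ⊆∧⊉⇒⊂ : ∀ {p q : Subset n} → p ⊆ q → ¬ q ⊆ p → p ⊂ q
  ⊆∧⊉⇒⊂ {p} {q} p⊆q q⊈p with any? (λ x → (x ∈? q) ×-dec ¬? (x ∈? p))
  ... | yes e = p⊆q , e
  ... | no ¬e = ⊥-elim (q⊈p λ {x} x∈q → decidable-stable (x ∈? p) λ x∉p → ¬e (x , x∈q , x∉p))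

  ⊆∧≢⇒⊂ : ∀ {p q : Subset n} → p ⊆ q → p ≢ q → p ⊂ q
  ⊆∧≢⇒⊂ p⊆q p≢q = ⊆∧⊉⇒⊂ p⊆q λ q⊆p → p≢q (⊆-antisym p⊆q q⊆p)

  ⊂⇒⊉ : ∀ {p q : Subset n} → p ⊂ q → ¬ q ⊆ p
  ⊂⇒⊉ (_ , x , x∈q , x∉p) q⊆p = x∉p (q⊆p x∈q)

  ⊂⇒≢ : ∀ {p q : Subset n} → p ⊂ q → p ≢ q
  ⊂⇒≢ p⊂q refl = ⊂⇒⊉ p⊂q id

-- Linear extensions of inclusion, and extremal members of chains.

-- Lexicographic order with `false` before `true`, which extends inclusion.
ascending : ∀ n → List (Subset n)
ascending zero    = [] ∷ []
ascending (suc n) = map (false ∷_) (ascending n) ++ map (true ∷_) (ascending n)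

∈-ascending : ∀ {n} (F : Subset n) → F ∈ˡ ascending n
∈-ascending []          = here refl
∈-ascending (false ∷ F) = ∈-++⁺ˡ (∈-map⁺ (false ∷_) (∈-ascending F))
∈-ascending (true ∷ F)  = ∈-++⁺ʳ _ (∈-map⁺ (true ∷_) (∈-ascending F))

ascending-sorted : ∀ n → AllPairs (λ F G → ¬ G ⊆ F) (ascending n)
ascending-sorted zero    = [] ∷ []
ascending-sorted (suc n) =
  AllPairs.++⁺ (lift false) (lift true)
    (All.map⁺ (All.universal (λ F → All.map⁺ (All.universal (λ G G⊆F → case G⊆F here of λ ()) _)) _))
  where
  lift : ∀ b → AllPairs (λ F G → ¬ G ⊆ F) (map (b ∷_) (ascending n))
  lift b = AllPairs.map⁺ (AllPairs.map (λ G⊈F → G⊈F ∘ drop-∷-⊆) (ascending-sorted n))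

descending : ∀ n → List (Subset n)
descending n = map ∁ (ascending n)

∈-descending : ∀ {n} (F : Subset n) → F ∈ˡ descending n
∈-descending F = subst (_∈ˡ _) ∁∁ (∈-map⁺ ∁ (∈-ascending (∁ F)))
  where
  ∁∁ : ∁ (∁ F) ≡ F
  ∁∁ = ⊆-antisym (λ x∈ → x∉∁p⇒x∈p (x∈∁p⇒x∉p x∈)) (λ x∈ → x∉p⇒x∈∁p (x∈p⇒x∉∁p x∈))

descending-sorted : ∀ n → AllPairs (λ F G → ¬ F ⊆ G) (descending n)
descending-sorted n =
  AllPairs.map⁺ (AllPairs.map (λ G⊈F → G⊈F ∘ anti) (ascending-sorted n))
  where
  anti : ∀ {F G : Subset n} → ∁ F ⊆ ∁ G → G ⊆ F
  anti = ∁p⊆∁q⇒p⊇q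

-- A running maximum, used to find the neighbour of a flat in a chain. `R` is inclusion or its
-- reverse, and `B` is the end of the interval, returned when nothing in `L` satisfies `Q`.
extremum : ∀ {A : Set} {R : A → A → Set} {Q : A → Set} (B : A) → (∀ {x} → R x x) →
           (∀ {x y z} → R x y → R y z → R x z) → (∀ x → Dec (Q x)) →
           (∀ {x} → Q x → R B x) → (∀ {x y} → Q x → Q y → R x y ⊎ R y x) →
           ∀ L → ∃ λ m → (m ≡ B ⊎ Q m) × (∀ {x} → x ∈ˡ L → Q x → R x m)
extremum B r t Q? B≤ total [] = B , inj₁ refl , λ ()
extremum {R = R} {Q} B r t Q? B≤ total (y ∷ L)
  with extremum B r t Q? B≤ total L | Q? y
... | m , m∈ , max | no ¬q = m , m∈ , λ { (here refl) q → ⊥-elim (¬q q) ; (there x∈) → max x∈ }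
... | m , m∈ , max | yes q with [ (λ { refl → inj₂ (B≤ q) }) , total q ]′ m∈
...   | inj₁ y≤m = m , m∈ , λ { (here refl) _ → y≤m ; (there x∈) → max x∈ }
...   | inj₂ m≤y = y , inj₂ q , λ { (here refl) _ → r ; (there x∈) p → t (max x∈ p) m≤y }

-- Closure and independence in a matroid.

module Bergman {n : ℕ} (M : Matroid n) where
  open Matroid M
  open Decomposition (BVertex-≟ {n}) public

  pattern y i = inj₁ i
  pattern x F = inj₂ F

  Face : Set
  Face = BVertex M → Bool

  cl-mono : ∀ {X Y} → X ⊆ Y → cl X ⊆ cl Y
  cl-mono = monotone _ _

  ∈-cl : ∀ {X} → X ⊆ cl X
  ∈-cl = extensive _

  cl-least : ∀ {X F} → IsFlat M F → X ⊆ F → cl X ⊆ F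
  cl-least fl X⊆F {i} i∈ = subst (i ∈_) fl (cl-mono X⊆F i∈)

  cl-lub : ∀ {X Y} → X ⊆ cl Y → cl X ⊆ cl Y
  cl-lub = cl-least (idempotent _)

  -- The usual condition that no element lies in the closure of the others; the next two lemmas
  -- identify it with `Independent`.
  record Indep (S : Subset n) : Set where
    constructor indep
    field apart : ∀ i → i ∈ S → i ∉ cl (S - i)
  open Indep

  -- If `i` were in the closure of `S - i`, then so would be all of `S`, and the two closures would
  -- coincide.
  Independent⇒Indep : ∀ {S} → Independent M S → Indep S
  Independent⇒Indep {S} ind = indep λ i i∈S i∈cl →
    ⊂⇒⊉ (ind i i∈S) (cl-lub λ {j} j∈S → case j ≟ᶠ i of λ
      { (yes refl) → i∈cl ; (no j≢i) → ∈-cl (x∈p∧x≢y⇒x∈p-y j∈S j≢i) })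

  Indep⇒Independent : ∀ {S} → Indep S → Independent M S
  Indep⇒Independent {S} ind i i∈S = cl-mono (p─q⊆p S ⁅ i ⁆) , i , ∈-cl i∈S , apart ind i i∈S

  indep-⊆ : ∀ {S T} → S ⊆ T → Indep T → Indep S
  indep-⊆ {S} S⊆T ind = indep λ i i∈S i∈cl → apart ind i (S⊆T i∈S) (cl-mono
    (λ j∈ → let j∈S , j≢i = ∈-⁻ {p = S} j∈ in x∈p∧x≢y⇒x∈p-y (S⊆T j∈S) j≢i) i∈cl)

  indep-⊥ : Indep ⊥
  indep-⊥ = indep λ i i∈ → ⊥-elim (∉⊥ i∈)

  -- If some `i` in `S` became dependent on `S - i` and `v`, exchange would put `v` in the closure
  -- of `S`. A subset `T` is allowed so that the elements of an enlarged face fit directly.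
  indep-insert : ∀ {S T v} → Indep S → v ∉ cl S → T ⊆ S ∪ ⁅ v ⁆ → Indep T
  indep-insert {S} {T} {v} ind v∉ T⊆ = indep apart′
    where
    ∈T : ∀ {j} → j ∈ T → j ∈ S ⊎ j ≡ v
    ∈T j∈T = map₂ (x∈⁅y⁆⇒x≡y v) (x∈p∪q⁻ S _ (T⊆ j∈T))
    apart′ : ∀ i → i ∈ T → i ∉ cl (T - i)
    apart′ i i∈T i∈cl with ∈T i∈T
    ... | inj₂ refl = v∉ (cl-mono (λ j∈ → let j∈T , j≢v = ∈-⁻ {p = T} j∈ in
            [ id , ⊥-elim ∘ j≢v ]′ (∈T j∈T)) i∈cl)
    ... | inj₁ i∈S = v∉ (cl-mono (∪-lub (p─q⊆p S ⁅ i ⁆) (⁅⁆⊆ i∈S))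
                          (exchange _ _ _ (cl-mono T-i⊆ i∈cl) (apart ind i i∈S)))
      where
      T-i⊆ : T - i ⊆ (S - i) ∪ ⁅ v ⁆
      T-i⊆ j∈ = let j∈T , j≢i = ∈-⁻ {p = T} j∈ in
        [ (λ j∈S → ⊆∪ˡ (x∈p∧x≢y⇒x∈p-y j∈S j≢i)) , (λ { refl → ∈∪⁅⁆ {p = S - i} }) ]′ (∈T j∈T)

  -- Independence complexes of minors.

  ys : Face → Subset n
  ys τ = tabulate (τ ∘ inj₁)

  ∈-ys⁺ : ∀ {τ i} → y i ∈ᶠ τ → i ∈ ys τ
  ∈-ys⁺ {τ} {i} (mem p) = lookup⇒[]= i _ (trans (lookup∘tabulate _ i) p)

  ∈-ys⁻ : ∀ {τ i} → i ∈ ys τ → y i ∈ᶠ τ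
  ∈-ys⁻ {τ} {i} p = mem (trans (sym (lookup∘tabulate _ i)) ([]=⇒lookup p))

  ys-mono : ∀ {σ τ} → σ ⊑ τ → ys σ ⊆ ys τ
  ys-mono σ⊑τ i∈ = ∈-ys⁺ (σ⊑τ _ (∈-ys⁻ i∈))

  ys-add : ∀ {i τ} → ys (add (y i) τ) ⊆ ys τ ∪ ⁅ i ⁆
  ys-add {i} {τ} j∈ with ∈-add⁻ (∈-ys⁻ j∈)
  ... | inj₁ j∈τ  = ⊆∪ˡ (∈-ys⁺ j∈τ)
  ... | inj₂ refl = ∈∪⁅⁆ {p = ys τ}

  ys-add-x : ∀ {F τ} → ys (add (x F) τ) ⊆ ys τ
  ys-add-x j∈ with ∈-add⁻ (∈-ys⁻ j∈)
  ... | inj₁ j∈τ = ∈-ys⁺ j∈τ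

  ys-∅ : ys ∅ᶠ ⊆ ⊥
  ys-∅ i∈ = ⊥-elim (∉∅ (∈-ys⁻ {∅ᶠ} i∈))

  -- The independence complex of the restriction to I ∪ W of M, contracted by I.
  IN : Subset n → Subset n → Complex (BVertex M)
  IN I W τ = (∀ F → x F ∉ᶠ τ) × (∀ i → y i ∈ᶠ τ → i ∈ W) × Indep (I ∪ ys τ)

  IN-downClosed : ∀ {I W} → DownClosed (IN I W)
  IN-downClosed σ⊑τ (nox , ⊆W , ind) =
    (λ F → nox F ∘ σ⊑τ _) , (λ i → ⊆W i ∘ σ⊑τ _)
    , indep-⊆ (∪-lub ⊆∪ˡ (⊆∪ʳ ∘ ys-mono σ⊑τ)) ind

  -- Deletion and contraction of an element `v`, by induction on the size of `W`. A loop is dropped,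
  -- a coloop is the apex of a cone, and any other `v` is shed: its deletion removes `v` from `W`,
  -- its link moves `v` from `W` to `I`.
  IN-decomposable : ∀ I W → Indep I → (∀ {i} → i ∈ W → i ∉ I) → Acc _<_ ∣ W ∣ →
                    Decomposable (IN I W)
  IN-decomposable I W indI W∩I (acc rec) with nonempty? W
  ... | no empty = simplex ∅ᶠ λ τ → mk⇔
    (λ (nox , ⊆W , _) → λ { (y i) p → ⊥-elim (empty (i , ⊆W i p)) ; (x F) p → ⊥-elim (nox F p) })
    (λ τ⊑∅ → (λ F → ∉∅ ∘ τ⊑∅ _) , (λ i p → ⊥-elim (∉∅ (τ⊑∅ _ p)))
           , indep-⊆ (∪-lub id (λ i∈ → ⊥-elim (∉⊥ (ys-∅ (ys-mono τ⊑∅ i∈))))) indI)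
  -- The first test asks whether `v` is a loop of the minor, the second whether it fails to be a
  -- coloop.
  ... | yes (v , v∈W) = cases (v ∈? cl I) (v ∈? cl (I ∪ (W - v)))
    where
    W′⊆W : W - v ⊆ W
    W′⊆W = p─q⊆p W ⁅ v ⁆

    W′ : ∀ {i} → i ∈ W → i ≢ v → i ∈ W - v
    W′ = x∈p∧x≢y⇒x∈p-y

    v∉I : v ∉ I
    v∉I = W∩I v∈W

    IH : ∀ J → Indep J → (∀ {i} → i ∈ W - v → i ∉ J) → Decomposable (IN J (W - v))
    IH J indJ d = IN-decomposable J (W - v) indJ d (rec (x∈p⇒∣p-x∣<∣p∣ v∈W))

    shrink : ∀ {τ} → y v ∉ᶠ τ → IN I W τ → IN I (W - v) τ
    shrink v∉τ (nox , ⊆W , ind) = nox , (λ i p → W′ (⊆W i p) λ { refl → v∉τ p }) , ind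

    grow : ∀ {τ} → IN I (W - v) τ → IN I W τ
    grow (nox , ⊆W , ind) = nox , (λ i → W′⊆W ∘ ⊆W i) , ind

    v∉W′ : ∀ {J τ} → IN J (W - v) τ → y v ∉ᶠ τ
    v∉W′ (_ , ⊆W , _) p = proj₂ (∈-⁻ {p = W} (⊆W v p)) refl

    v∉cl : ∀ {τ} → y v ∉ᶠ τ → Indep (I ∪ ys (add (y v) τ)) → v ∉ cl (I ∪ ys τ)
    v∉cl {τ} v∉τ ind = apart ind v (⊆∪ʳ {p = I} (∈-ys⁺ ∈-add⁺ʳ)) ∘ cl-mono (∪-lub
      (λ j∈I → x∈p∧x≢y⇒x∈p-y (⊆∪ˡ j∈I) λ { refl → v∉I j∈I })
      (λ j∈ → x∈p∧x≢y⇒x∈p-y (⊆∪ʳ {p = I} (ys-mono (λ _ → ∈-add⁺ˡ) j∈)) λ { refl → v∉τ (∈-ys⁻ j∈) }))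

    insert : ∀ {w τ} → w ∈ W → w ∉ cl (I ∪ ys τ) → IN I W τ → IN I W (add (y w) τ)
    insert {w} {τ} w∈W w∉ (nox , ⊆W , ind) =
      (λ F p → [ nox F , (λ ()) ]′ (∈-add⁻ p))
      , (λ i p → [ ⊆W i , (λ { refl → w∈W }) ]′ (∈-add⁻ p))
      , indep-insert ind w∉ (∪-lub (⊆∪ˡ ∘ ⊆∪ˡ) (∪-lub (⊆∪ˡ ∘ ⊆∪ʳ {p = I}) ⊆∪ʳ ∘ ys-add))

    cases : Dec (v ∈ cl I) → Dec (v ∈ cl (I ∪ (W - v))) → Decomposable (IN I W)
    cases (yes v∈clI) _ = Decomposable-resp (λ τ → mk⇔ grow λ t → shrink (loop t) t)
                            (IH I indI (W∩I ∘ W′⊆W))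
      where
      loop : ∀ {τ} → IN I W τ → y v ∉ᶠ τ
      loop (_ , _ , ind) p = apart ind v (⊆∪ʳ {p = I} (∈-ys⁺ p))
        (cl-mono (λ j∈I → x∈p∧x≢y⇒x∈p-y (⊆∪ˡ j∈I) λ { refl → v∉I j∈I }) v∈clI)
    cases (no _) (no coloop) =
      cone-decomposable (y v) IN-downClosed v∉W′ (IH I indI (W∩I ∘ W′⊆W)) λ τ → mk⇔
        (λ t → shrink (λ p → proj₂ (remove⁻ (y v) τ p) refl)
                 (IN-downClosed (λ _ → proj₁ ∘ remove⁻ (y v) τ) t))
        (λ t@(_ , ⊆W , _) → IN-downClosed
           (λ u p → case BVertex-≟ u (y v) of λ
             { (yes refl) → ∈-add⁺ʳ ; (no u≢v) → ∈-add⁺ˡ (remove⁺ (y v) τ p u≢v) })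
           (insert v∈W (coloop ∘ cl-mono (∪-lub ⊆∪ˡ λ {j} j∈ → ⊆∪ʳ {p = I} (⊆W j (∈-ys⁻ j∈)))) (grow t)))
    cases (no v∉clI) (yes v∈cl) = shed (y v)
      (insert v∈W (v∉clI ∘ cl-mono (∪-lub id (⊥⊆ ∘ ys-∅)))
        ((λ F → ∉∅) , (λ i → ⊥-elim ∘ ∉∅) , indep-⊆ (∪-lub id (⊥⊆ ∘ ys-∅)) indI))
      (Decomposable-resp (λ τ → mk⇔ (λ t → grow t , v∉W′ t) (λ (t , v∉τ) → shrink v∉τ t))
        (IH I indI (W∩I ∘ W′⊆W)))
      (Decomposable-resp (λ τ → mk⇔ link⁻ link⁺)
        (IH (I ∪ ⁅ v ⁆) (indep-insert indI v∉clI id)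
          λ i∈ i∈I∪v → let i∈W , i≢v = ∈-⁻ {p = W} i∈ in
            [ W∩I i∈W , i≢v ∘ x∈⁅y⁆⇒x≡y v ]′ (x∈p∪q⁻ I _ i∈I∪v)))
      exch
      where
      link⁻ : ∀ {τ} → IN (I ∪ ⁅ v ⁆) (W - v) τ → Link (y v) (IN I W) τ
      link⁻ t@(nox , ⊆W , ind) =
        ( (λ F p → [ nox F , (λ ()) ]′ (∈-add⁻ p))
        , (λ i p → [ W′⊆W ∘ ⊆W i , (λ { refl → v∈W }) ]′ (∈-add⁻ p))
        , indep-⊆ (∪-lub (⊆∪ˡ ∘ ⊆∪ˡ)
                    (∪-lub ⊆∪ʳ (⊆∪ˡ ∘ ⊆∪ʳ {p = I}) ∘ ys-add)) ind)
        , v∉W′ t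
      link⁺ : ∀ {τ} → Link (y v) (IN I W) τ → IN (I ∪ ⁅ v ⁆) (W - v) τ
      link⁺ ((nox , ⊆W , ind) , v∉τ) =
        (λ F → nox F ∘ ∈-add⁺ˡ)
        , (λ i p → W′ (⊆W i (∈-add⁺ˡ p)) λ { refl → v∉τ p })
        , indep-⊆ (∪-lub (∪-lub ⊆∪ˡ (⁅⁆⊆ (⊆∪ʳ {p = I} (∈-ys⁺ ∈-add⁺ʳ))))
                         (⊆∪ʳ {p = I} ∘ ys-mono λ _ → ∈-add⁺ˡ)) ind
      exch : Exchangeable (IN I W) (y v)
      exch τ (t@(_ , _ , ind) , v∉τ)
        with any? (λ w → (w ∈? (W - v)) ×-dec ¬? (w ∈? cl (I ∪ ys τ)))
      ... | yes (w , w∈W′ , w∉cl) =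
        y w , (λ { refl → proj₂ (∈-⁻ {p = W} w∈W′) refl }) , (λ p → w∉cl (∈-cl (⊆∪ʳ {p = I} (∈-ys⁺ p))))
        , insert (W′⊆W w∈W′) w∉cl (IN-downClosed (λ _ → ∈-add⁺ˡ) t)
      -- If nothing in `W - v` could be added, the closure of `I ∪ ys τ` would contain `W - v`,
      -- hence `v`, as `v` is not a coloop.
      ... | no none = ⊥-elim (v∉cl v∉τ ind (cl-lub (∪-lub (∈-cl ∘ ⊆∪ˡ)
        λ {w} w∈ → decidable-stable (w ∈? _) λ w∉ → none (w , w∈ , w∉)) v∈cl))

  -- Order complexes of families of subsets.

  Chain : Face → Set
  Chain τ = ∀ H K → x H ∈ᶠ τ → x K ∈ᶠ τ → H ⊆ K ⊎ K ⊆ H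

  -- The order complex of the subsets satisfying `P`, ordered by inclusion.
  OC : (Subset n → Set) → Complex (BVertex M)
  OC P τ = (∀ i → y i ∉ᶠ τ) × (∀ H → x H ∈ᶠ τ → P H) × Chain τ

  chain-⊑ : ∀ {σ τ} → σ ⊑ τ → Chain τ → Chain σ
  chain-⊑ σ⊑τ ch H K p q = ch H K (σ⊑τ _ p) (σ⊑τ _ q)

  chain-add : ∀ {K τ} → Chain τ → (∀ H → x H ∈ᶠ τ → H ⊆ K ⊎ K ⊆ H) → Chain (add (x K) τ)
  chain-add ch cmp H H′ p q with ∈-add⁻ p | ∈-add⁻ q
  ... | inj₁ a    | inj₁ b    = ch H H′ a b
  ... | inj₁ a    | inj₂ refl = cmp H a
  ... | inj₂ refl | inj₁ b    = swap (cmp H′ b)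
  ... | inj₂ refl | inj₂ refl = inj₁ id

  chain-comparable : ∀ {K τ H} → Chain (add (x K) τ) → x K ∉ᶠ τ → x H ∈ᶠ τ → H ⊂ K ⊎ K ⊂ H
  chain-comparable {K} {τ} {H} ch K∉τ p = strict (ch H K (∈-add⁺ˡ p) ∈-add⁺ʳ)
    where
    H≢K : H ≢ K
    H≢K refl = K∉τ p
    strict : H ⊆ K ⊎ K ⊆ H → H ⊂ K ⊎ K ⊂ H
    strict (inj₁ H⊆K) = inj₁ (⊆∧≢⇒⊂ H⊆K H≢K)
    strict (inj₂ K⊆H) = inj₂ (⊆∧≢⇒⊂ K⊆H (H≢K ∘ sym))

  OC-downClosed : ∀ {P} → DownClosed (OC P)
  OC-downClosed σ⊑τ (noy , P , ch) = (λ i → noy i ∘ σ⊑τ _) , (λ H → P H ∘ σ⊑τ _) , chain-⊑ σ⊑τ ch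

  OC-mono : ∀ {P Q τ} → (∀ H → x H ∈ᶠ τ → P H → Q H) → OC P τ → OC Q τ
  OC-mono P⇒Q (noy , P , ch) = noy , (λ H p → P⇒Q H p (P H p)) , ch

  OC-resp : ∀ {P Q} → Decomposable (OC P) → (∀ H → P H ⇔ Q H) → Decomposable (OC Q)
  OC-resp D e = flip Decomposable-resp D λ τ →
    mk⇔ (OC-mono λ H _ → to (e H)) (OC-mono λ H _ → from (e H))

  OC-empty : ∀ {P} → (∀ H → ¬ P H) → Decomposable (OC P)
  OC-empty ¬P = simplex ∅ᶠ λ τ → mk⇔
    (λ (noy , P , _) → λ { (y i) p → ⊥-elim (noy i p) ; (x F) p → ⊥-elim (¬P F (P F p)) })
    (λ τ⊑∅ → (λ i → ∉∅ ∘ τ⊑∅ _) , (λ F → ⊥-elim ∘ ∉∅ ∘ τ⊑∅ _)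
           , (λ F _ → ⊥-elim ∘ ∉∅ ∘ τ⊑∅ _))

  OC-insert : ∀ {P K τ} → P K → (∀ H → x H ∈ᶠ τ → H ⊆ K ⊎ K ⊆ H) → OC P τ → OC P (add (x K) τ)
  OC-insert PK cmp (noy , P , ch) =
    (λ i p → [ noy i , (λ ()) ]′ (∈-add⁻ p))
    , (λ H p → [ P H , (λ { refl → PK }) ]′ (∈-add⁻ p))
    , chain-add ch cmp

  OC-∅ : ∀ {P} → OC P ∅ᶠ
  OC-∅ = (λ _ → ∉∅) , (λ _ → ⊥-elim ∘ ∉∅) , λ _ _ → ⊥-elim ∘ ∉∅

  OC-Del : ∀ {P K} → OC (λ H → P H × H ≢ K) ≈ Del (x K) (OC P)
  OC-Del τ = mk⇔
    (λ t@(_ , Q , _) → OC-mono (λ _ _ → proj₁) t , λ p → proj₂ (Q _ p) refl)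
    (λ (t , K∉τ) → OC-mono (λ H p PH → PH , λ { refl → K∉τ p }) t)

  -- The separating predicate for the link of `x K`: in a chain through `K`, whatever is not below
  -- `K` lies above it.
  below : Subset n → Face
  below K (y _) = false
  below K (x H) = ⌊ H ⊆? K ⌋

  ∈-below⁻ : ∀ {K H} → x H ∈ᶠ below K → H ⊆ K
  ∈-below⁻ {K} {H} (mem p) with H ⊆? K
  ... | yes H⊆K = H⊆K

  ∈-below⁺ : ∀ {K H} → H ⊆ K → x H ∈ᶠ below K
  ∈-below⁺ {K} {H} H⊆K with H ⊆? K in eq
  ... | yes _  = mem (cong ⌊_⌋ eq)
  ... | no H⊈K = ⊥-elim (H⊈K H⊆K)

  -- Everything below `K` is contained in everything above it, so the two halves of a chain through
  -- `K` can be chosen independently.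
  OC-Link : ∀ {P K} → P K → Link (x K) (OC P) ≈
            Join (below K) (OC (λ H → P H × H ⊂ K)) (OC (λ H → P H × K ⊂ H))
  OC-Link {P} {K} PK τ = mk⇔
    (λ (t@(noy , Q , ch) , K∉τ) →
      OC-mono (λ H p PH → let p₁ , p₂ = ∈-∩⁻ p in
                PH , [ id , (λ K⊂H → ⊥-elim (⊂⇒⊉ K⊂H (∈-below⁻ p₂))) ]′
                       (chain-comparable ch K∉τ p₁))
              (OC-downClosed (λ _ → ∈-add⁺ˡ ∘ proj₁ ∘ ∈-∩⁻) t)
      , OC-mono (λ H p PH → let p₁ , p₂ = ∈-∖⁻ p in
                PH , (case chain-comparable ch K∉τ p₁ of λ
                  { (inj₁ H⊂K) → ⊥-elim (p₂ (∈-below⁺ {K} (proj₁ H⊂K))) ; (inj₂ K⊂H) → K⊂H }))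
              (OC-downClosed (λ _ → ∈-add⁺ˡ ∘ proj₁ ∘ ∈-∖⁻) t))
    (λ (lo , hi) → glue lo hi)
    where
    glue : OC (λ H → P H × H ⊂ K) (τ ∩ᶠ below K) → OC (λ H → P H × K ⊂ H) (τ ∖ᶠ below K) →
           Link (x K) (OC P) τ
    glue (_ , lo , ch₁) (noy , hi , ch₂) =
      OC-insert PK comparable
        ( (λ i p → noy i (∈-∖⁺ p λ { (mem ()) }))
        , (λ H p → [ proj₁ ∘ lo H ∘ proj₂ , proj₁ ∘ hi H ∘ proj₂ ]′ (split H p))
        , chain)
      , λ p → ⊂⇒≢ (proj₂ (lo K (∈-∩⁺ p (∈-below⁺ id)))) refl
      where
      split : ∀ H → x H ∈ᶠ τ → (H ⊆ K × x H ∈ᶠ τ ∩ᶠ below K) ⊎ (K ⊆ H × x H ∈ᶠ τ ∖ᶠ below K)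
      split H p with H ⊆? K
      ... | yes H⊆K = inj₁ (H⊆K , ∈-∩⁺ p (∈-below⁺ H⊆K))
      ... | no H⊈K  = let p′ = ∈-∖⁺ p (H⊈K ∘ ∈-below⁻) in inj₂ (proj₁ (proj₂ (hi H p′)) , p′)
      comparable : ∀ H → x H ∈ᶠ τ → H ⊆ K ⊎ K ⊆ H
      comparable H p with split H p
      ... | inj₁ (H⊆K , _) = inj₁ H⊆K
      ... | inj₂ (K⊆H , _) = inj₂ K⊆H
      chain : Chain τ
      chain H H′ p q with split H p | split H′ q
      ... | inj₁ (_ , a)   | inj₁ (_ , b)   = ch₁ H H′ a b
      ... | inj₂ (_ , a)   | inj₂ (_ , b)   = ch₂ H H′ a b
      ... | inj₁ (H⊆K , _) | inj₂ (K⊆H′ , _) = inj₁ (⊆-trans H⊆K K⊆H′)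
      ... | inj₂ (K⊆H , _) | inj₁ (H′⊆K , _) = inj₂ (⊆-trans H′⊆K K⊆H)

  OC-Link-decomposable : ∀ {P K} → P K → Decomposable (OC (λ H → P H × H ⊂ K)) →
    Decomposable (OC (λ H → P H × K ⊂ H)) → Decomposable (Link (x K) (OC P))
  OC-Link-decomposable {P} {K} PK lo hi =
    Join-decomposable OC-downClosed OC-downClosed lower upper lo hi (OC-Link PK)
    where
    lower : SupportedIn (below K) (OC (λ H → P H × H ⊂ K))
    lower (noy , _ , _) (y i) p = ⊥-elim (noy i p)
    lower (_ , Q , _)   (x H) p = ∈-below⁺ {K} (proj₁ (proj₂ (Q H p)))
    upper : SupportedIn (not ∘ below K) (OC (λ H → P H × K ⊂ H))
    upper (noy , _ , _) (y i) p = ⊥-elim (noy i p)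
    upper (_ , Q , _)   (x H) p = ∈-not⁺ λ q → ⊂⇒⊉ (proj₂ (Q H p)) (∈-below⁻ q)

  -- The least member `c` is comparable to all others, so it can be added to every chain.
  OC-cone : ∀ {P c} → P c → (∀ H → P H → c ⊆ H) → Decomposable (OC (λ H → P H × c ⊂ H)) →
            Decomposable (OC P)
  OC-cone {P} {c} Pc c≤ D =
    cone-decomposable (x c) OC-downClosed (λ (_ , Q , _) p → ⊂⇒≢ (proj₂ (Q c p)) refl) D λ τ → mk⇔
      (λ t → OC-mono (λ H p PH →
               PH , ⊆∧≢⇒⊂ (c≤ H PH) λ { refl → proj₂ (remove⁻ (x c) τ p) refl })
               (OC-downClosed (λ _ → proj₁ ∘ remove⁻ (x c) τ) t))
      (λ t@(_ , Q , _) → OC-downClosed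
        (λ u p → case BVertex-≟ u (x c) of λ
          { (yes refl) → ∈-add⁺ʳ ; (no u≢c) → ∈-add⁺ˡ (remove⁺ (x c) τ p u≢c) })
        (OC-insert Pc (λ H p → inj₂ (c≤ H (proj₁ (Q H p)))) (OC-mono (λ _ _ → proj₁) t)))

  -- Intervals in the lattice of flats.

  Interval : Subset n → Subset n → Subset n → Set
  Interval F G H = IsFlat M H × F ⊂ H × H ⊂ G

  HalfOpen : Subset n → Subset n → Subset n → Set
  HalfOpen c G H = IsFlat M H × c ⊆ H × H ⊂ G

  -- A cone with apex `c` over the open interval, or empty when `c` is not strictly inside `G`.
  halfOpen-decomposable : ∀ {c G} → IsFlat M c → Decomposable (OC (Interval c G)) →
                          Decomposable (OC (HalfOpen c G))
  halfOpen-decomposable {c} {G} fl D with c ⊂? G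
  ... | no c⊄G  = OC-empty λ H (_ , c⊆H , H⊂G) → c⊄G (⊆-⊂-trans c⊆H H⊂G)
  ... | yes c⊂G = OC-cone (fl , id , c⊂G) (λ _ → proj₁ ∘ proj₂) (OC-resp D (λ H → mk⇔
    (λ (fl , c⊂H , H⊂G) → (fl , proj₁ c⊂H , H⊂G) , c⊂H)
    (λ ((fl , _ , H⊂G) , c⊂H) → fl , c⊂H , H⊂G)))

  _∨ᶠ_ : Subset n → Fin n → Subset n
  F ∨ᶠ a = cl (F ∪ ⁅ a ⁆)

  ∨ᶠ-flat : ∀ {F a} → IsFlat M (F ∨ᶠ a)
  ∨ᶠ-flat = idempotent _

  ∨ᶠ-least : ∀ {F a H} → IsFlat M H → F ⊆ H → a ∈ H → F ∨ᶠ a ⊆ H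
  ∨ᶠ-least fl F⊆H a∈H = cl-least fl (∪-lub F⊆H (⁅⁆⊆ a∈H))

  ⊆∨ᶠ : ∀ {F a} → F ⊆ F ∨ᶠ a
  ⊆∨ᶠ = ∈-cl ∘ ⊆∪ˡ

  ∈∨ᶠ : ∀ {F a} → a ∈ F ∨ᶠ a
  ∈∨ᶠ {F} = ∈-cl (∈∪⁅⁆ {p = F})

  -- Flats of (F, G) avoiding a ∈ G ∖ F are shed from the largest to the smallest. Such a flat K can
  -- be exchanged for X ∨ a, where X is the predecessor of K in the chain; the link of K is the
  -- join of (F, K) with [K ∨ a, G). What is left at the end is the cone [F ∨ a, G).
  module _ {F G a} (flF : IsFlat M F) (flG : IsFlat M G) (F⊆G : F ⊆ G) (a∈G : a ∈ G) (a∉F : a ∉ F)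
    (lower : ∀ {K} → IsFlat M K → K ⊂ G → Decomposable (OC (Interval F K)))
    (upper : ∀ {c} → IsFlat M c → F ⊂ c → Decomposable (OC (Interval c G))) where

    -- The flats still present while those of `L` await their turn. Flats containing `a` are never
    -- shed, even when they occur in `L`.
    Remaining : List (Subset n) → Subset n → Set
    Remaining L H = Interval F G H × (a ∈ H ⊎ H ∈ˡ L)

    -- The two hypotheses determine the link of the head `K`: by `down` all flats of the interval
    -- below `K` are still present, and by sortedness those left above `K` contain `a`.
    sweep : ∀ L → AllPairs (λ K H → ¬ K ⊆ H) L → (∀ {H K} → K ∈ˡ L → H ⊆ K → H ∈ˡ L) →
            Decomposable (OC (Remaining L))
    sweep [] _ _ = OC-resp
      (halfOpen-decomposable ∨ᶠ-flat (upper ∨ᶠ-flat (⊆∨ᶠ , a , ∈∨ᶠ {F} , a∉F)))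
      (λ H → mk⇔
        (λ (fl , c⊆H , H⊂G) →
          (fl , (⊆∨ᶠ′ {H} c⊆H , a , c⊆H (∈∨ᶠ {F}) , a∉F) , H⊂G) , inj₁ (c⊆H (∈∨ᶠ {F})))
        (λ { ((fl , F⊂H , H⊂G) , inj₁ a∈H) → fl , ∨ᶠ-least fl (proj₁ F⊂H) a∈H , H⊂G }))
      where
      ⊆∨ᶠ′ : ∀ {H} → F ∨ᶠ a ⊆ H → F ⊆ H
      ⊆∨ᶠ′ c⊆H = c⊆H ∘ ⊆∨ᶠ
    sweep (K ∷ L) (K⊈L ∷ sorted) down =
      cases ((≡-dec _≟ᵇ_ (cl K) K ×-dec (F ⊂? K ×-dec K ⊂? G)) ×-dec ¬? (a ∈? K))
      where
      K∉L : ∀ {H} → H ∈ˡ L → ¬ K ⊆ H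
      K∉L = All.lookup K⊈L

      IH : Decomposable (OC (Remaining L))
      IH = sweep L sorted λ K′∈L H⊆K′ → case down (there K′∈L) H⊆K′ of λ
        { (here refl) → ⊥-elim (K∉L K′∈L H⊆K′) ; (there H∈L) → H∈L }

      cases : Dec (Interval F G K × a ∉ K) → Decomposable (OC (Remaining (K ∷ L)))
      -- `K` contains `a` or is no flat of the interval, so passing over it changes nothing.
      cases (no ¬K) = OC-resp IH (λ H → mk⇔
        (λ (int , r) → int , map₂ there r)
        (λ { (int , inj₁ a∈H) → int , inj₁ a∈H
           ; (int , inj₂ (there H∈L)) → int , inj₂ H∈L
           ; (int , inj₂ (here refl)) →
               int , inj₁ (decidable-stable (a ∈? K) λ a∉K → ¬K (int , a∉K)) }))
      cases (yes (intK@(flK , F⊂K , K⊂G) , a∉K)) = shed (x K)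
        (OC-insert PK (λ _ → ⊥-elim ∘ ∉∅) OC-∅)
        (Decomposable-resp OC-Del (OC-resp IH (λ H → mk⇔
          (λ (int , r) → (int , map₂ there r)
                       , λ { refl → [ a∉K , (λ K∈L → K∉L K∈L id) ]′ r })
          (λ { ((int , inj₁ a∈H) , _) → int , inj₁ a∈H
             ; ((int , inj₂ (there H∈L)) , _) → int , inj₂ H∈L
             ; ((int , inj₂ (here refl)) , H≢K) → ⊥-elim (H≢K refl) }))))
        (OC-Link-decomposable PK
          (OC-resp (lower flK K⊂G) (λ H → mk⇔
            (λ (fl , F⊂H , H⊂K) →
              ((fl , F⊂H , ⊂-trans H⊂K K⊂G) , inj₂ (down (here refl) (proj₁ H⊂K))) , H⊂K)
            (λ (((fl , F⊂H , _) , _) , H⊂K) → fl , F⊂H , H⊂K)))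
          (OC-resp (halfOpen-decomposable ∨ᶠ-flat
              (upper ∨ᶠ-flat (⊂-⊆-trans F⊂K ⊆∨ᶠ))) (λ H → mk⇔
            (λ (fl , c⊆H , H⊂G) →
              let a∈H = c⊆H (∈∨ᶠ {K})
                  K⊂H = (λ {i} i∈ → c⊆H (⊆∨ᶠ i∈)) , a , a∈H , a∉K in
              ((fl , ⊂-trans F⊂K K⊂H , H⊂G) , inj₁ a∈H) , K⊂H)
            (λ (r@((fl , _ , H⊂G) , _) , K⊂H) →
              fl , ∨ᶠ-least fl (proj₁ K⊂H) (above∋a r K⊂H) , H⊂G))))
        exch
        where
        PK : Remaining (K ∷ L) K
        PK = intK , inj₂ (here refl)

        above∋a : ∀ {H} → Remaining (K ∷ L) H → K ⊂ H → a ∈ H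
        above∋a (_ , inj₁ a∈H) _ = a∈H
        above∋a (_ , inj₂ (here refl)) K⊂H = ⊥-elim (⊂⇒≢ K⊂H refl)
        above∋a (_ , inj₂ (there H∈L)) K⊂H = ⊥-elim (K∉L H∈L (proj₁ K⊂H))

        exch : Exchangeable (OC (Remaining (K ∷ L))) (x K)
        exch τ ((noy , P , ch) , K∉τ)
          -- The largest member of the chain strictly below `K`, or `F` if there is none.
          with extremum {R = _⊆_} {Q = λ H → x H ∈ᶠ τ × H ⊂ K} F id (λ p q → q ∘ p)
                 (λ H → (x H ∈ᶠ? τ) ×-dec (H ⊂? K))
                 (λ {H} (p , _) → proj₁ (proj₁ (proj₂ (proj₁ (P H (∈-add⁺ˡ p))))))
                 (λ (p , _) (q , _) → ch _ _ (∈-add⁺ˡ p) (∈-add⁺ˡ q))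
                 (ascending n)
        ... | X , X∈ , max = replace flX F⊆X X⊂K
          where
          flX : IsFlat M X
          flX = [ (λ { refl → flF }) , (λ (p , _) → proj₁ (proj₁ (P X (∈-add⁺ˡ p)))) ]′ X∈
          F⊆X : F ⊆ X
          F⊆X {i} = [ (λ { refl → id })
                    , (λ (p , _) → proj₁ (proj₁ (proj₂ (proj₁ (P X (∈-add⁺ˡ p)))))) ]′ X∈
          X⊂K : X ⊂ K
          X⊂K = [ (λ { refl → F⊂K }) , proj₂ ]′ X∈
          replace : IsFlat M X → F ⊆ X → X ⊂ K →
                    ∃ λ w → w ≢ x K × w ∉ᶠ τ × OC (Remaining (K ∷ L)) (add w τ)
          replace flX F⊆X (X⊆K , e , e∈K , e∉X) =
            x D , (λ { refl → a∉K a∈D })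
            , (λ p → [ (λ D⊂K → a∉K (proj₁ D⊂K a∈D)) , (λ K⊂D → e∉D (proj₁ K⊂D e∈K)) ]′
                       (chain-comparable ch K∉τ p))
            , OC-insert
                (intD , inj₁ a∈D)
                comparable
                (OC-downClosed (λ _ → ∈-add⁺ˡ) (noy , P , ch))
            where
            D : Subset n
            D = X ∨ᶠ a
            a∈D : a ∈ D
            a∈D = ∈∨ᶠ {X}
            -- Otherwise exchange puts `a` in the closure of `X ∪ ⁅ e ⁆`, which lies in `K`. Thus
            -- `D` contains neither `K` nor `G`.
            e∉D : e ∉ D
            e∉D e∈D = a∉K (∨ᶠ-least flK X⊆K e∈K
              (exchange _ _ _ e∈D (subst (e ∉_) (sym flX) e∉X)))
            intD : Interval F G D
            intD = ∨ᶠ-flat , ((λ i∈ → ⊆∨ᶠ (F⊆X i∈)) , a , a∈D , a∉F)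
                 , (∨ᶠ-least flG (λ i∈ → proj₁ K⊂G (X⊆K i∈)) a∈G , e , proj₁ K⊂G e∈K , e∉D)
            -- Below `K` the chain stays inside `X`; above `K` its flats contain both `X` and `a`.
            comparable : ∀ H → x H ∈ᶠ τ → H ⊆ D ⊎ D ⊆ H
            comparable H p with chain-comparable ch K∉τ p
            ... | inj₁ H⊂K = inj₁ λ i∈ → ⊆∨ᶠ (max (∈-ascending H) (p , H⊂K) i∈)
            ... | inj₂ K⊂H = let PH = P H (∈-add⁺ˡ p) in
              inj₂ (∨ᶠ-least (proj₁ (proj₁ PH)) (λ i∈ → proj₁ K⊂H (X⊆K i∈)) (above∋a PH K⊂H))

  -- Induction on `k`, a bound on the difference in size between `G` and `F`; moving either end
  -- strictly inwards lowers it.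
  interval-decomposable : ∀ k {F G} → IsFlat M F → IsFlat M G → ∣ G ∣ ≤ ∣ F ∣ + k →
                          Decomposable (OC (Interval F G))
  interval-decomposable k {F} {G} flF flG le with F ⊂? G
  ... | no F⊄G = OC-empty λ H (_ , F⊂H , H⊂G) → F⊄G (⊂-trans F⊂H H⊂G)
  interval-decomposable zero {F} {G} flF flG le | yes F⊂G =
    ⊥-elim (ℕₚ.<⇒≱ (p⊂q⇒∣p∣<∣q∣ F⊂G) (subst (∣ G ∣ ≤_) (ℕₚ.+-identityʳ ∣ F ∣) le))
  interval-decomposable (suc k) {F} {G} flF flG le | yes (F⊆G , a , a∈G , a∉F) =
    OC-resp (sweep flF flG F⊆G a∈G a∉F
        (λ {K} flK K⊂G → interval-decomposable k flF flK
          (ℕₚ.≤-pred (ℕₚ.≤-trans (p⊂q⇒∣p∣<∣q∣ K⊂G) le′)))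
        (λ {c} flc F⊂c → interval-decomposable k flc flG
          (ℕₚ.≤-trans le′ (ℕₚ.+-monoˡ-≤ k (p⊂q⇒∣p∣<∣q∣ F⊂c))))
        (descending n) (descending-sorted n) (λ {H} _ _ → ∈-descending H))
      (λ H → mk⇔ proj₁ (λ int → int , inj₂ (∈-descending H)))
    where
    le′ : ∣ G ∣ ≤ suc ∣ F ∣ + k
    le′ = subst (∣ G ∣ ≤_) (ℕₚ.+-suc ∣ F ∣ k) le

  -- Shedding the flats of the augmented Bergman complex.

  -- The augmented Bergman complex restricted to flats satisfying `P`, with chains unordered.
  -- Containment of the independent set in every flat of the chain replaces containment of its
  -- closure in the first.
  AugWith : (Subset n → Set) → Complex (BVertex M)
  AugWith P τ = (∀ F → x F ∈ᶠ τ → IsProperFlat M F × P F × ys τ ⊆ F) × Chain τ × Indep (ys τ)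

  AugWith-downClosed : ∀ {P} → DownClosed (AugWith P)
  AugWith-downClosed σ⊑τ (fl , ch , ind) =
    (λ F p → let a , b , ⊆F = fl F (σ⊑τ _ p) in a , b , λ i∈ → ⊆F (ys-mono σ⊑τ i∈))
    , chain-⊑ σ⊑τ ch , indep-⊆ (ys-mono σ⊑τ) ind

  AugWith-mono : ∀ {P Q τ} → (∀ F → x F ∈ᶠ τ → P F → Q F) → AugWith P τ → AugWith Q τ
  AugWith-mono P⇒Q (fl , ch , ind) =
    (λ F p → let a , b , ⊆F = fl F p in a , P⇒Q F p b , λ {i} → ⊆F {i}) , ch , ind

  AugWith-resp : ∀ {P Q} → Decomposable (AugWith P) → (∀ F → IsProperFlat M F → P F ⇔ Q F) →
                 Decomposable (AugWith Q)
  AugWith-resp D e = flip Decomposable-resp D λ τ → mk⇔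
    (λ t → AugWith-mono (λ F p → to (e F (proj₁ (proj₁ t F p)))) t)
    (λ t → AugWith-mono (λ F p → from (e F (proj₁ (proj₁ t F p)))) t)

  ⊤-flat : IsFlat M ⊤
  ⊤-flat = ⊆-antisym (λ _ → ∈⊤) ∈-cl

  proper⇒⊂⊤ : ∀ {F} → IsProperFlat M F → F ⊂ ⊤
  proper⇒⊂⊤ (_ , F≢⊤) = ⊆∧≢⇒⊂ (λ _ → ∈⊤) F≢⊤

  element : Face
  element (y _) = true
  element (x _) = false

  IN-⊥-decomposable : ∀ W → Decomposable (IN ⊥ W)
  IN-⊥-decomposable W = IN-decomposable ⊥ W indep-⊥ (λ _ → ∉⊥) (<-wellFounded _)

  -- By sortedness no flat left lies strictly below the head `K`, and by `up` all those above it are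
  -- left, so the link of `K` involves the whole interval from `K` to `⊤`. With no flats left, the
  -- independence complex of `M` remains.
  sweepUp : ∀ L → AllPairs (λ K H → ¬ H ⊆ K) L → (∀ {K H} → K ∈ˡ L → K ⊆ H → H ∈ˡ L) →
            Decomposable (AugWith (_∈ˡ L))
  sweepUp [] _ _ = flip Decomposable-resp (IN-⊥-decomposable ⊤) λ τ → mk⇔
    (λ (nox , _ , ind) → (λ F p → ⊥-elim (nox F p)) , (λ F _ p → ⊥-elim (nox F p))
                       , indep-⊆ ⊆∪ʳ ind)
    (λ (fl , _ , ind) → (λ F p → case proj₁ (proj₂ (fl F p)) of λ ()) , (λ _ _ → ∈⊤)
                      , indep-⊆ (∪-lub ⊥⊆ id) ind)
  sweepUp (K ∷ L) (L⊈K ∷ sorted) up =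
    cases (≡-dec _≟ᵇ_ (cl K) K ×-dec ¬? (≡-dec _≟ᵇ_ K ⊤))
    where
    ⊈K : ∀ {H} → H ∈ˡ L → ¬ H ⊆ K
    ⊈K = All.lookup L⊈K

    up′ : ∀ {H H′} → H ∈ˡ L → H ⊆ H′ → H′ ∈ˡ L
    up′ H∈L H⊆H′ with up (there H∈L) H⊆H′
    ... | here refl   = ⊥-elim (⊈K H∈L H⊆H′)
    ... | there H′∈L = H′∈L

    IH : Decomposable (AugWith (_∈ˡ L))
    IH = sweepUp L sorted up′

    cases : Dec (IsProperFlat M K) → Decomposable (AugWith (_∈ˡ K ∷ L))
    cases (no ¬K) = AugWith-resp IH λ H H-proper → mk⇔ there λ
      { (here refl) → ⊥-elim (¬K H-proper) ; (there H∈L) → H∈L }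
    cases (yes K-proper@(flK , _)) = shed (x K) vertex
      (Decomposable-resp del≈ IH)
      (Join-decomposable IN-downClosed OC-downClosed lower upper
        (IN-⊥-decomposable K)
        -- `n` bounds the size of `⊤`, hence also the difference in size from `K`.
        (interval-decomposable n flK ⊤-flat (ℕₚ.≤-trans (∣p∣≤n ⊤) (ℕₚ.m≤n+m n _)))
        link≈)
      exch
      where
      lower : SupportedIn element (IN ⊥ K)
      lower _             (y i) p = mem refl
      lower (nox , _ , _) (x F) p = ⊥-elim (nox F p)

      upper : SupportedIn (not ∘ element) (OC (Interval K ⊤))
      upper (noy , _ , _) (y i) p = ⊥-elim (noy i p)
      upper _             (x F) p = mem refl

      flatInsert : ∀ {τ} → ys τ ⊆ K → (∀ H → x H ∈ᶠ τ → H ⊆ K ⊎ K ⊆ H) →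
                   AugWith (_∈ˡ K ∷ L) τ → AugWith (_∈ˡ K ∷ L) (add (x K) τ)
      flatInsert {τ} ys⊆K cmp (fl , ch , ind) = fl′ , chain-add ch cmp , indep-⊆ ys-add-x ind
        where
        fl′ : ∀ F → x F ∈ᶠ add (x K) τ → IsProperFlat M F × F ∈ˡ K ∷ L × ys (add (x K) τ) ⊆ F
        fl′ F p with ∈-add⁻ p
        ... | inj₁ q    = let a , b , ⊆F = fl F q in a , b , λ i∈ → ⊆F (ys-add-x i∈)
        ... | inj₂ refl = K-proper , here refl , λ i∈ → ys⊆K (ys-add-x i∈)

      vertex : AugWith (_∈ˡ K ∷ L) (add (x K) ∅ᶠ)
      vertex = flatInsert (⊥⊆ ∘ ys-∅) (λ _ → ⊥-elim ∘ ∉∅)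
        ((λ _ → ⊥-elim ∘ ∉∅) , (λ _ _ → ⊥-elim ∘ ∉∅) , indep-⊆ ys-∅ indep-⊥)

      del≈ : AugWith (_∈ˡ L) ≈ Del (x K) (AugWith (_∈ˡ K ∷ L))
      del≈ τ = mk⇔
        (λ t@(fl , _) → AugWith-mono (λ _ _ → there) t , λ p → ⊈K (proj₁ (proj₂ (fl K p))) id)
        (λ (t , K∉τ) → AugWith-mono
          (λ { _ p (here refl) → ⊥-elim (K∉τ p) ; _ _ (there H∈L) → H∈L }) t)

      above : ∀ {τ H} → Link (x K) (AugWith (_∈ˡ K ∷ L)) τ → x H ∈ᶠ τ → K ⊂ H
      above {H = H} ((fl , ch , _) , K∉τ) p
        with chain-comparable ch K∉τ p | proj₁ (proj₂ (fl H (∈-add⁺ˡ p)))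
      ... | inj₂ K⊂H | _           = K⊂H
      ... | inj₁ H⊂K | here refl   = ⊥-elim (⊂⇒≢ H⊂K refl)
      ... | inj₁ H⊂K | there H∈L = ⊥-elim (⊈K H∈L (proj₁ H⊂K))

      ys⊆K : ∀ {τ} → Link (x K) (AugWith (_∈ˡ K ∷ L)) τ → ys τ ⊆ K
      ys⊆K ((fl , _) , _) i∈ = proj₂ (proj₂ (fl K ∈-add⁺ʳ)) (ys-mono (λ _ → ∈-add⁺ˡ) i∈)

      -- Flats above `K` contain every subset of `K`, so the independent set and the chain can be
      -- chosen independently.
      link≈ : Link (x K) (AugWith (_∈ˡ K ∷ L)) ≈ Join element (IN ⊥ K) (OC (Interval K ⊤))
      link≈ τ = mk⇔ split glue
        where
        split : Link (x K) (AugWith (_∈ˡ K ∷ L)) τ → Join element (IN ⊥ K) (OC (Interval K ⊤)) τ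
        split t@((fl , ch , ind) , K∉τ) =
          ( (λ F p → case proj₂ (∈-∩⁻ p) of λ { (mem ()) })
          , (λ i p → ys⊆K t (∈-ys⁺ (proj₁ (∈-∩⁻ p))))
          , indep-⊆ (∪-lub ⊥⊆ (ys-mono λ _ p → ∈-add⁺ˡ (proj₁ (∈-∩⁻ p)))) ind)
          , (λ i p → proj₂ (∈-∖⁻ p) (mem refl))
          , (λ H p → let q = proj₁ (∈-∖⁻ p) ; H-proper = proj₁ (fl H (∈-add⁺ˡ q)) in
               proj₁ H-proper , above t q , proper⇒⊂⊤ H-proper)
          , chain-⊑ (λ _ p → ∈-add⁺ˡ (proj₁ (∈-∖⁻ p))) ch
        glue : Join element (IN ⊥ K) (OC (Interval K ⊤)) τ → Link (x K) (AugWith (_∈ˡ K ∷ L)) τ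
        glue ((_ , ⊆K , ind) , (_ , int , ch)) =
          flatInsert ys⊆ (λ H p → inj₂ (K⊆ p))
            ( (λ H p → let flH , K⊂H , H⊂⊤ = int H (flat p) in
                 (flH , ⊂⇒≢ H⊂⊤) , up (here refl) (proj₁ K⊂H) , λ i∈ → proj₁ K⊂H (ys⊆ i∈))
            , (λ H H′ p q → ch H H′ (flat p) (flat q))
            , indep-⊆ (λ i∈ → ⊆∪ʳ {p = ⊥} (∈-ys⁺ (elem (∈-ys⁻ i∈)))) ind)
          , λ p → ⊂⇒≢ (proj₁ (proj₂ (int K (flat p)))) refl
          where
          flat : ∀ {H} → x H ∈ᶠ τ → x H ∈ᶠ τ ∖ᶠ element
          flat p = ∈-∖⁺ p λ { (mem ()) }
          elem : ∀ {i} → y i ∈ᶠ τ → y i ∈ᶠ τ ∩ᶠ element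
          elem p = ∈-∩⁺ p (mem refl)
          ys⊆ : ys τ ⊆ K
          ys⊆ i∈ = ⊆K _ (elem (∈-ys⁻ i∈))
          K⊆ : ∀ {H} → x H ∈ᶠ τ → K ⊆ H
          K⊆ {H} p = proj₁ (proj₁ (proj₂ (int H (flat p))))

      -- An element of X ∖ K, where X is the smallest flat in the chain above K (or the whole
      -- ground set), can always be added in place of K.
      exch : Exchangeable (AugWith (_∈ˡ K ∷ L)) (x K)
      exch τ t@((fl , ch , ind) , K∉τ)
        with extremum {R = λ F G → G ⊆ F} {Q = λ H → x H ∈ᶠ τ} ⊤ id (λ p q → p ∘ q)
               (λ H → x H ∈ᶠ? τ) (λ _ _ → ∈⊤) (λ p q → swap (ch _ _ (∈-add⁺ˡ p) (∈-add⁺ˡ q)))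
               (ascending n)
      ... | X , X∈ , min = replace K⊂X
        where
        K⊂X : K ⊂ X
        K⊂X = [ (λ { refl → proper⇒⊂⊤ K-proper }) , above t ]′ X∈
        replace : K ⊂ X → ∃ λ w → w ≢ x K × w ∉ᶠ τ × AugWith (_∈ˡ K ∷ L) (add w τ)
        replace (_ , i , i∈X , i∉K) = y i , (λ ()) , (λ p → i∉K (ys⊆K t (∈-ys⁺ p)))
          , fl′
          , (λ H H′ p q → ch H H′ (flat p) (flat q))
          -- The elements of `τ` lie in the flat `K`, so their closure misses `i`.
          , indep-insert (indep-⊆ (ys-mono λ _ → ∈-add⁺ˡ) ind)
              (λ i∈ → i∉K (cl-least flK (ys⊆K t) i∈)) ys-add
          where
          fl′ : ∀ F → x F ∈ᶠ add (y i) τ → IsProperFlat M F × F ∈ˡ K ∷ L × ys (add (y i) τ) ⊆ F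
          fl′ F p with ∈-add⁻ p
          ... | inj₁ q = let a , b , ⊆F = fl F (∈-add⁺ˡ q) in a , b , λ j∈ →
            ∪-lub (λ k∈ → ⊆F (ys-mono (λ _ → ∈-add⁺ˡ) k∈))
                  (⁅⁆⊆ (min (∈-ascending F) q i∈X)) (ys-add j∈)
          flat : ∀ {H} → x H ∈ᶠ add (y i) τ → x H ∈ᶠ add (x K) τ
          flat p with ∈-add⁻ p
          ... | inj₁ q = ∈-add⁺ˡ q

  -- Comparison with the list-based definition.

  -- A linked list is pairwise comparable by transitivity. Conversely, filtering `ascending n` lists
  -- a chain in increasing order, since that order extends inclusion.
  AugBergman≈ : AugBergman M ≈ AugWith (_∈ˡ ascending n)
  AugBergman≈ τ = mk⇔ fwd bwd
    where
    fwd : AugBergman M τ → AugWith (_∈ˡ ascending n) τ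
    fwd (I , Fs , ind , proper , linked , chain , ys≡ , xs⇔) =
      (λ F p → All.lookup proper (to (xs⇔ F) (isTrue p)) , ∈-ascending F
             , λ i∈ → I⊆ Fs linked chain (to (xs⇔ F) (isTrue p)) (ys⊆I i∈))
      , (λ H K p q → comparable (Linked⇒AllPairs ⊂-trans linked)
                       (to (xs⇔ H) (isTrue p)) (to (xs⇔ K) (isTrue q)))
      , indep-⊆ ys⊆I (Independent⇒Indep ind)
      where
      ys⊆I : ys τ ⊆ I
      ys⊆I {i} i∈ = lookup⇒[]= i I (trans (sym (ys≡ i)) (isTrue (∈-ys⁻ {τ} i∈)))
      I⊆ : ∀ Fs → Linked _⊂_ Fs → ChainAbove M I Fs → ∀ {F} → F ∈ˡ Fs → I ⊆ F
      I⊆ (_ ∷ _) _ clI⊆F (here refl) i∈ = clI⊆F (∈-cl i∈)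
      I⊆ (_ ∷ G ∷ Fs) (F⊂G ∷ l) clI⊆F (there F∈) i∈ =
        I⊆ (G ∷ Fs) l (λ j∈ → proj₁ F⊂G (clI⊆F j∈)) F∈ i∈
      comparable : ∀ {Fs H K} → AllPairs _⊂_ Fs → H ∈ˡ Fs → K ∈ˡ Fs → H ⊆ K ⊎ K ⊆ H
      comparable _ (here refl) (here refl) = inj₁ id
      comparable (F⊂ ∷ _) (here refl) (there K∈) = inj₁ (proj₁ (All.lookup F⊂ K∈))
      comparable (F⊂ ∷ _) (there H∈) (here refl) = inj₂ (proj₁ (All.lookup F⊂ H∈))
      comparable (_ ∷ ps) (there H∈) (there K∈) = comparable ps H∈ K∈

    bwd : AugWith (_∈ˡ ascending n) τ → AugBergman M τ
    bwd (fl , ch , ind) = ys τ , flats , Indep⇒Independent ind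
      , All.tabulate (λ F∈ → proj₁ (fl _ (∈τ F∈)))
      , AllPairs⇒Linked (chain (λ F∈ → F∈) (AllPairs.filter⁺ _ (ascending-sorted n)))
      , chainAbove (λ F∈ → F∈)
      , (λ i → sym (lookup∘tabulate _ i))
      , (λ F → mk⇔ (λ p → ∈-filter⁺ (λ F → x F ∈ᶠ? τ) (∈-ascending F) (mem p))
                   (λ F∈ → isTrue (∈τ F∈)))
      where
      flats : List (Subset n)
      flats = filter (λ F → x F ∈ᶠ? τ) (ascending n)
      ∈τ : ∀ {F} → F ∈ˡ flats → x F ∈ᶠ τ
      ∈τ F∈ = proj₂ (∈-filter⁻ (λ F → x F ∈ᶠ? τ) {xs = ascending n} F∈)
      strict : ∀ {F G} → x F ∈ᶠ τ → x G ∈ᶠ τ → ¬ G ⊆ F → F ⊂ G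
      strict {F} {G} p q G⊈F with ch F G p q
      ... | inj₁ F⊆G = ⊆∧⊉⇒⊂ F⊆G G⊈F
      ... | inj₂ G⊆F = ⊥-elim (G⊈F G⊆F)
      chain : ∀ {Fs} → (∀ {F} → F ∈ˡ Fs → F ∈ˡ flats) → AllPairs (λ F G → ¬ G ⊆ F) Fs →
              AllPairs _⊂_ Fs
      chain _ [] = []
      chain sub (F⊉ ∷ ps) =
        All.tabulate (λ G∈ → strict (∈τ (sub (here refl))) (∈τ (sub (there G∈))) (All.lookup F⊉ G∈))
        ∷ chain (sub ∘ there) ps
      chainAbove : ∀ {Fs} → (∀ {F} → F ∈ˡ Fs → F ∈ˡ flats) → ChainAbove M (ys τ) Fs
      chainAbove {[]} _ = _
      chainAbove {F ∷ _} sub = let p , _ , ⊆F = fl F (∈τ (sub (here refl))) in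
        cl-least (proj₁ p) ⊆F

theorem1p1 : (n : ℕ) (M : Matroid n) → VertexDecomposable BVertex-≟ (AugBergman M)
theorem1p1 n M = vertexDecomposable AugWith-downClosed AugBergman≈
  (sweepUp (ascending n) (ascending-sorted n) (λ {_} {H} _ _ → ∈-ascending H))
  where open Bergman M
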